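{- Let $n,N$ be integers with $3\le n+1\le N$. (a) If $(S,w)$ is a non-trivial extreme ray of $P_{N,n}$, then $S\in H_{N,n}$. (b) If $S$ is an extreme ray of $H_{N,n}$, then there is a weight vector $w$ such that $(S,w)$ is a non-trivial extreme ray of $P_{N,n}$.
   Context: For a positive integer $k$ let $[k]=\{1,\dots,k\}$. $K_N$ is the undirected complete graph on vertex set $[N]$, with edge set $E_N=\{(i,j):1\le i<j\le N\}$. For a vector $w=(w(e))_{e\in E_N}$ and $W\subseteq[N]$, the cut $C(W)$ is the set of edges with exactly one endpoint in $W$, and $\|C(W)\|=\sum_{e\in C(W)}w(e)$. A nonnegative $w$ on $K_N$ realizes in $K_N$ the vector $S=(S_I)_{\varnothing\ne I\subseteq[n]}\in\mathbb{R}^{2^n-1}$ with $S_I=\min\{\|C(W)\| : W\subseteq[N-1],\ W\cap[n]=I\}$. $H_{N,n}$ is the convex hull of all $S\in\mathbb{R}^{2^n-1}$ realized by some nonnegative $w$ in $K_N$; it is a cone. $P_{N,n}$ is the cone of all $(S,w)\in\mathbb{R}^{2^n-1}\times\mathbb{R}^{E_N}$ (with $S$ and $w$ both variables) satisfying $$S_I\le\|C(W)\|\quad\text{for all } W\subseteq[N-1],\ \varnothing\ne I\subseteq[n]\text{ with } I=W\cap[n],\qquad w(e)\ge 0\quad\text{for all } e\in E_N.$$ Extreme rays are identified with their nonzero generating vectors up to positive scaling. An extreme ray of $P_{N,n}$ is called trivial if (up to positive scaling) it has either exactly one $S_I=-1$ and all other coordinates zero, or exactly one $w(e)=1$ and all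 other coordinates zero; otherwise it is non-trivial. -}

module Defs where

open import Algebra.Bundles using (CommutativeRing)
open import Data.Bool.Base using (if_then_else_; _xor_)
open import Data.Fin.Base using (Fin; toℕ; _<_)
open import Data.Fin.Properties using (_<?_)
open import Data.Fin.Subset using (Subset; Nonempty; _⊆_; _∩_)
open import Data.Nat.Base using (ℕ; _∸_)
import Data.Nat.Properties as ℕ
open import Data.Product.Base using (Σ-syntax; ∃-syntax; _×_)
open import Data.Sum.Base using (_⊎_; inj₁; inj₂)
open import Data.Vec.Base using (lookup; tabulate)
open import Level using (Level; _⊔_; suc)
open import Relation.Binary.Core using (Rel)
open import Relation.Binary.PropositionalEquality using (_≡_; _≢_)
open import Relation.Binary.Structures using (IsDecTotalOrder)
open import Relation.Nullary using (¬_; Dec; yes; no; does)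
open import Relation.Unary using (Pred)

-- The real numbers, axiomatised classically as a Dedekind-complete ordered
-- field (unique up to isomorphism); the order is decidable, as it is in
-- classical mathematics.
record RealField c ℓ₁ ℓ₂ : Set (suc (c ⊔ ℓ₁ ⊔ ℓ₂)) where
  field
    commutativeRing : CommutativeRing c ℓ₁

  open CommutativeRing commutativeRing public

  infix 4 _≤ᴿ_ _<ᴿ_

  field
    _≤ᴿ_            : Rel Carrier ℓ₂
    isDecTotalOrder : IsDecTotalOrder _≈_ _≤ᴿ_
    0≉1             : ¬ 0# ≈ 1#
    inverse         : ∀ x → ¬ x ≈ 0# → ∃[ y ] x * y ≈ 1#
    +-monoʳ-≤       : ∀ x {y z} → y ≤ᴿ z → x + y ≤ᴿ x + z
    *-nonneg        : ∀ {x y} → 0# ≤ᴿ x → 0# ≤ᴿ y → 0# ≤ᴿ x * y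

  _<ᴿ_ : Rel Carrier (ℓ₁ ⊔ ℓ₂)
  x <ᴿ y = x ≤ᴿ y × ¬ x ≈ y

  UpperBound : ∀ {ℓ} → Pred Carrier ℓ → Pred Carrier (c ⊔ ℓ₂ ⊔ ℓ)
  UpperBound A u = ∀ x → A x → x ≤ᴿ u

  field
    complete : (A : Pred Carrier (c ⊔ ℓ₁ ⊔ ℓ₂)) →
               (∃[ x ] A x) → (∃[ u ] UpperBound A u) →
               ∃[ s ] (UpperBound A s × (∀ u → UpperBound A u → s ≤ᴿ u))

  IsMinimum : ∀ {ℓ} → Pred Carrier ℓ → Pred Carrier (c ⊔ ℓ₂ ⊔ ℓ)
  IsMinimum A m = A m × (∀ x → A x → m ≤ᴿ x)

-- The vertex k + 1 of K_N is represented by the element of Fin N with value k.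
[_] : ∀ {N} → ℕ → Subset N
[ k ] = tabulate (λ v → does (toℕ v ℕ.<? k))

record Edge (N : ℕ) : Set where
  constructor edge
  field
    source target  : Fin N
    .source<target : source < target

-- The nonempty subsets of [n], viewed inside the vertex set [N]; for n ≤ N
-- there are 2ⁿ − 1 of them.  They index the coordinates of S.
record TerminalSet (N n : ℕ) : Set where
  constructor terminalSet
  field
    set       : Subset N
    .nonempty : Nonempty set
    .set⊆[n]  : set ⊆ [ n ]

module Rays {c ℓ₁ ℓ₂} (ℝ : RealField c ℓ₁ ℓ₂) where
  open RealField ℝ
  open import Algebra.Definitions.RawMonoid +-rawMonoid public using (sum)

  Vect : Set → Set c
  Vect X = X → Carrier

  module _ {X : Set} where

    IsNonnegMultipleOf : Vect X → Vect X → Set (c ⊔ ℓ₁ ⊔ ℓ₂)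
    IsNonnegMultipleOf x y = ∃[ t ] (0# ≤ᴿ t × (∀ k → y k ≈ t * x k))

    -- x generates an extreme ray of the cone K, i.e. { t x ∣ t ≥ 0 } is a
    -- one-dimensional face of K.
    ExtremeRay : ∀ {ℓ} → Pred (Vect X) ℓ → Pred (Vect X) (c ⊔ ℓ₁ ⊔ ℓ₂ ⊔ ℓ)
    ExtremeRay K x =
      K x ×
      ¬ (∀ k → x k ≈ 0#) ×
      (∀ y z → K y → K z → (∀ k → y k + z k ≈ x k) →
       IsNonnegMultipleOf x y × IsNonnegMultipleOf x z)

    ConvexHull : ∀ {ℓ} → Pred (Vect X) ℓ → Pred (Vect X) (c ⊔ ℓ₁ ⊔ ℓ₂ ⊔ ℓ)
    ConvexHull A x =
      ∃[ m ] Σ[ t ∈ (Fin m → Carrier) ] Σ[ p ∈ (Fin m → Vect X) ]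
        ((∀ i → 0# ≤ᴿ t i) × sum t ≈ 1# ×
         (∀ i → A (p i)) ×
         (∀ k → x k ≈ sum (λ i → t i * p i k)))

    SupportedAt : X → Carrier → Vect X → Set ℓ₁
    SupportedAt k a x = x k ≈ a × (∀ j → j ≢ k → x j ≈ 0#)

module Cuts {c ℓ₁ ℓ₂} (ℝ : RealField c ℓ₁ ℓ₂) (N n : ℕ) where
  open RealField ℝ
  open Rays ℝ public

  edgeSum : Vect (Edge N) → Carrier
  edgeSum f = sum {N} λ i → sum {N} λ j → term i j (i <? j)
    where
    term : (i j : Fin N) → Dec (i < j) → Carrier
    term i j (yes i<j) = f (edge i j i<j)
    term i j (no  _)   = 0#

  ∥C_∥ : Subset N → Vect (Edge N) → Carrier
  ∥C W ∥ w = edgeSum λ e →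
    if lookup W (Edge.source e) xor lookup W (Edge.target e) then w e else 0#

  -- W ⊆ [N−1] and W ∩ [n] = I
  Extends : TerminalSet N n → Pred (Subset N) _
  Extends I W = W ⊆ [ N ∸ 1 ] × W ∩ [ n ] ≡ TerminalSet.set I

  Nonneg : Vect (Edge N) → Set ℓ₂
  Nonneg w = ∀ e → 0# ≤ᴿ w e

  Realizes : Vect (Edge N) → Vect (TerminalSet N n) → Set (c ⊔ ℓ₁ ⊔ ℓ₂)
  Realizes w S =
    Nonneg w ×
    (∀ I → IsMinimum (λ x → ∃[ W ] (Extends I W × x ≈ ∥C W ∥ w)) (S I))

  H : Pred (Vect (TerminalSet N n)) (c ⊔ ℓ₁ ⊔ ℓ₂)
  H = ConvexHull (λ S → ∃[ w ] Realizes w S)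

  -- A pair (S , w) is a single vector, with coordinates S_I and w(e).
  Coordinate : Set
  Coordinate = TerminalSet N n ⊎ Edge N

  P : Pred (Vect Coordinate) ℓ₂
  P x =
    (∀ W I → Extends I W → x (inj₁ I) ≤ᴿ ∥C W ∥ (λ e → x (inj₂ e))) ×
    Nonneg (λ e → x (inj₂ e))

  Trivial : Pred (Vect Coordinate) (c ⊔ ℓ₁ ⊔ ℓ₂)
  Trivial x = ∃[ t ] (0# <ᴿ t ×
    ( (∃[ I ] SupportedAt (inj₁ I) (- 1#) (λ k → t * x k))
    ⊎ (∃[ e ] SupportedAt (inj₂ e) 1#     (λ k → t * x k))))

  NontrivialExtremeRay : Pred (Vect Coordinate) (c ⊔ ℓ₁ ⊔ ℓ₂)
  NontrivialExtremeRay x = ExtremeRay P x × ¬ Trivial x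

{-# OPTIONS --safe #-}

-- (a) Let m(w) be the vector of minimum cuts of w.  The splitting
-- (S , w) = (m(w) , w) + (S − m(w) , 0) inside P forces, on an extreme ray, either S = m(w),
-- or w = 0 and S ≤ 0; in the latter case a negative coordinate splits off and the ray is trivial.
--
-- (b) An extreme ray S of H is a positive multiple of any nonzero term of a convex combination
-- expressing it, hence realized by some w.  Among the w with ‖C(W)‖ ≥ S_I and w ≥ 0, walk from
-- this one along directions annihilated by all tight constraints, until the tight constraints
-- determine w; cuts attaining S stay tight on the way, so S is still realized.  If then
-- (S , w) = (S′ , w′) + (S″ , w″) in P, every tight constraint is tight for the summands too.
-- So w′ realizes S′, whence S′ = t S by extremality of S, and w′ − t w, being annihilated by all
-- tight constraints, is 0.

module Submission where

open import Defs renaming ([_] to initial)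

import Algebra.Properties.Ring
import Algebra.Properties.Semiring.Sum
open import Data.Bool.Base using (Bool; true; false; T; if_then_else_; _xor_)
import Data.Bool.Properties as Bool
open import Data.Empty using (⊥-elim)
open import Data.Fin.Base using (Fin; zero; suc; toℕ; combine; remQuot)
import Data.Fin.Properties as Fin
open import Data.Fin.Subset using (Subset; inside; outside; _⊆_; _∩_)
  renaming (_∈_ to _∈ˢ_)
open import Data.Fin.Subset.Properties
  using (_⊆?_; nonempty?; p∩q⊆p; p∩q⊆q; ⊆-antisym; x∈p∩q⁺)
open import Data.List.Base
  using (List; []; _∷_; _++_; map; filter; length; concatMap; allFin; cartesianProductWith)
import Data.List.Extrema
open import Data.List.Membership.Propositional using (_∈_; find; lose)
open import Data.List.Membership.Propositional.Properties
  using (∈-map⁺; ∈-filter⁺; ∈-filter⁻; ∈-++⁺ˡ; ∈-++⁺ʳ; ∈-concatMap⁺; ∈-allFin;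
         ∈-cartesianProductWith⁺)
open import Data.List.Properties using (filter-notAll)
open import Data.List.Relation.Unary.All as All using (All)
import Data.List.Relation.Unary.All.Properties as All
open import Data.List.Relation.Unary.Any as Any using (here; there)
open import Data.Nat.Base as ℕ using (ℕ; s≤s; _<_; _≤_; _∸_)
import Data.Nat.Properties as ℕ
open import Data.Product.Base using (_×_; _,_; ∃-syntax; proj₁; proj₂; uncurry)
open import Data.Sum.Base using (_⊎_; inj₁; inj₂; [_,_]; fromInj₂)
open import Data.Unit.Base using (tt)
open import Data.Vec.Base using ([]; _∷_; lookup)
open import Data.Vec.Properties using (≡-dec; lookup⇒[]=; []=⇒lookup; lookup∘tabulate)
open import Function.Base using (_∘_; case_of_)
open import Level using (_⊔_)
open import Relation.Binary.Bundles using (TotalOrder)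
open import Relation.Binary.PropositionalEquality as ≡ using (_≡_; _≢_)
import Relation.Binary.Reasoning.PartialOrder
open import Relation.Binary.Structures using (IsDecTotalOrder)
open import Relation.Nullary
  using (¬_; ¬?; Dec; yes; no; contradiction; contradiction-irr; recompute)
open import Relation.Nullary.Decidable using (decidable-stable; dec-true; _×-dec_)

-- Arithmetic in an ordered field.

module OrderedField {c ℓ₁ ℓ₂} (ℝ : RealField c ℓ₁ ℓ₂) where
  open RealField ℝ hiding (zero)
  open Algebra.Properties.Ring ring public
    using (-‿distribˡ-*; -‿distribʳ-*; -1*x≈-x; +-inverseˡ-unique; +-inverseʳ-unique;
           -‿involutive; x∙y⁻¹≈ε⇒x≈y; -0#≈0#; ⁻¹-anti-homo‿-)
  open IsDecTotalOrder isDecTotalOrder public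
    using (_≟_; _≤?_; total; antisym; isTotalOrder)
    renaming (refl to ≤-refl; trans to ≤-trans; reflexive to ≤-reflexive)

  totalOrder : TotalOrder c ℓ₁ ℓ₂
  totalOrder = record { isTotalOrder = isTotalOrder }

  open Data.List.Extrema totalOrder public using (argmin; argmin-all; f[argmin]≤f[xs])
  module ≤-Reasoning = Relation.Binary.Reasoning.PartialOrder (TotalOrder.poset totalOrder)
  open ≤-Reasoning

  +-monoˡ-≤ : ∀ z {x y} → x ≤ᴿ y → x + z ≤ᴿ y + z
  +-monoˡ-≤ z {x} {y} x≤y = begin
    x + z ≈⟨ +-comm x z ⟩
    z + x ≤⟨ +-monoʳ-≤ z x≤y ⟩
    z + y ≈⟨ +-comm z y ⟩
    y + z ∎

  +-mono-≤ : ∀ {x y u v} → x ≤ᴿ y → u ≤ᴿ v → x + u ≤ᴿ y + v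
  +-mono-≤ {y = y} {u} x≤y u≤v = ≤-trans (+-monoˡ-≤ u x≤y) (+-monoʳ-≤ y u≤v)

  x+y-y≈x : ∀ x y → x + y - y ≈ x
  x+y-y≈x x y = trans (+-assoc x y (- y)) (trans (+-congˡ (-‿inverseʳ y)) (+-identityʳ x))

  x-y+y≈x : ∀ x y → x - y + y ≈ x
  x-y+y≈x x y = trans (+-assoc x (- y) y) (trans (+-congˡ (-‿inverseˡ y)) (+-identityʳ x))

  +-cancelʳ-≤ : ∀ z {x y} → x + z ≤ᴿ y + z → x ≤ᴿ y
  +-cancelʳ-≤ z {x} {y} p = begin
    x         ≈⟨ x+y-y≈x x z ⟨
    x + z - z ≤⟨ +-monoˡ-≤ (- z) p ⟩
    y + z - z ≈⟨ x+y-y≈x y z ⟩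
    y         ∎

  x≤y⇒0≤y-x : ∀ {x y} → x ≤ᴿ y → 0# ≤ᴿ y - x
  x≤y⇒0≤y-x {x} {y} x≤y = begin
    0#    ≈⟨ -‿inverseʳ x ⟨
    x - x ≤⟨ +-monoˡ-≤ (- x) x≤y ⟩
    y - x ∎

  x≤y⇒x-y≤0 : ∀ {x y} → x ≤ᴿ y → x - y ≤ᴿ 0#
  x≤y⇒x-y≤0 {x} {y} x≤y = begin
    x - y ≤⟨ +-monoˡ-≤ (- y) x≤y ⟩
    y - y ≈⟨ -‿inverseʳ y ⟩
    0#    ∎

  x≤0⇒0≤-x : ∀ {x} → x ≤ᴿ 0# → 0# ≤ᴿ - x
  x≤0⇒0≤-x {x} x≤0 = ≤-trans (x≤y⇒0≤y-x x≤0) (≤-reflexive (+-identityˡ (- x)))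

  neg-antimono-≤ : ∀ {x y} → x ≤ᴿ y → - y ≤ᴿ - x
  neg-antimono-≤ {x} {y} x≤y = +-cancelʳ-≤ y (begin
    - y + y ≈⟨ -‿inverseˡ y ⟩
    0#      ≤⟨ x≤y⇒0≤y-x x≤y ⟩
    y - x   ≈⟨ +-comm y (- x) ⟩
    - x + y ∎)

  *-monoˡ-≤-nonneg : ∀ {z x y} → 0# ≤ᴿ z → x ≤ᴿ y → z * x ≤ᴿ z * y
  *-monoˡ-≤-nonneg {z} {x} {y} 0≤z x≤y = begin
    z * x                 ≈⟨ +-identityˡ _ ⟨
    0# + z * x            ≤⟨ +-monoˡ-≤ _ (*-nonneg 0≤z (x≤y⇒0≤y-x x≤y)) ⟩
    z * (y - x) + z * x   ≈⟨ distribˡ z (y - x) x ⟨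
    z * (y - x + x)       ≈⟨ *-congˡ (x-y+y≈x y x) ⟩
    z * y                 ∎

  *-antimonoˡ-≤-nonpos : ∀ {z x y} → z ≤ᴿ 0# → x ≤ᴿ y → z * y ≤ᴿ z * x
  *-antimonoˡ-≤-nonpos {z} {x} {y} z≤0 x≤y = begin
    z * y       ≈⟨ z*x≈--z*x y ⟩
    - (- z * y) ≤⟨ neg-antimono-≤ (*-monoˡ-≤-nonneg (x≤0⇒0≤-x z≤0) x≤y) ⟩
    - (- z * x) ≈⟨ z*x≈--z*x x ⟨
    z * x       ∎
    where
    z*x≈--z*x : ∀ x → z * x ≈ - (- z * x)
    z*x≈--z*x x = trans (sym (-‿involutive _)) (-‿cong (-‿distribˡ-* z x))

  0≤1 : 0# ≤ᴿ 1#
  0≤1 with total 0# 1#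
  ... | inj₁ 0≤1 = 0≤1
  ... | inj₂ 1≤0 = begin
    0#           ≤⟨ *-nonneg (x≤0⇒0≤-x 1≤0) (x≤0⇒0≤-x 1≤0) ⟩
    - 1# * - 1#  ≈⟨ -1*x≈-x (- 1#) ⟩
    - - 1#       ≈⟨ -‿involutive 1# ⟩
    1#           ∎

  1≰0 : ¬ 1# ≤ᴿ 0#
  1≰0 1≤0 = 0≉1 (antisym 0≤1 1≤0)

  0≰-1 : ¬ 0# ≤ᴿ - 1#
  0≰-1 0≤-1 = 1≰0 (begin
    1#        ≈⟨ +-identityˡ 1# ⟨
    0# + 1#   ≤⟨ +-monoˡ-≤ 1# 0≤-1 ⟩
    - 1# + 1# ≈⟨ -‿inverseˡ 1# ⟩
    0#        ∎)

  *≈1⇒nonneg : ∀ {x y} → 0# ≤ᴿ x → x * y ≈ 1# → 0# ≤ᴿ y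
  *≈1⇒nonneg {x} {y} 0≤x xy≈1 with total 0# y
  ... | inj₁ 0≤y = 0≤y
  ... | inj₂ y≤0 = contradiction (begin
    0#        ≤⟨ *-nonneg 0≤x (x≤0⇒0≤-x y≤0) ⟩
    x * - y   ≈⟨ -‿distribʳ-* x y ⟨
    - (x * y) ≈⟨ -‿cong xy≈1 ⟩
    - 1#      ∎) 0≰-1

  *≈1⇒≉0 : ∀ {x y} → x * y ≈ 1# → ¬ y ≈ 0#
  *≈1⇒≉0 {x} xy≈1 y≈0 = 0≉1 (trans (sym (zeroʳ x)) (trans (*-congˡ (sym y≈0)) xy≈1))

  *-cancelˡ-≈0 : ∀ {x y} → ¬ x ≈ 0# → x * y ≈ 0# → y ≈ 0#
  *-cancelˡ-≈0 {x} {y} x≉0 xy≈0 with z , xz≈1 ← inverse x x≉0 = begin-equality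
    y           ≈⟨ *-identityˡ y ⟨
    1# * y      ≈⟨ *-congʳ xz≈1 ⟨
    x * z * y   ≈⟨ *-congʳ (*-comm x z) ⟩
    z * x * y   ≈⟨ *-assoc z x y ⟩
    z * (x * y) ≈⟨ *-congˡ xy≈0 ⟩
    z * 0#      ≈⟨ zeroʳ z ⟩
    0#          ∎

  -- The junk value is x⁻¹ = 0 for x ≈ 0.
  _⁻¹ : Carrier → Carrier
  x ⁻¹ with x ≟ 0#
  ... | yes _  = 0#
  ... | no x≉0 = proj₁ (inverse x x≉0)

  *-inverseʳ : ∀ {x} → ¬ x ≈ 0# → x * x ⁻¹ ≈ 1#
  *-inverseʳ {x} x≉0 with x ≟ 0#
  ... | yes x≈0 = contradiction x≈0 x≉0
  ... | no x≉0′ = proj₂ (inverse x x≉0′)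

  ⁻¹-nonneg : ∀ {x} → 0# ≤ᴿ x → 0# ≤ᴿ x ⁻¹
  ⁻¹-nonneg {x} 0≤x with x ≟ 0#
  ... | yes _  = ≤-refl
  ... | no x≉0 = *≈1⇒nonneg 0≤x (proj₂ (inverse x x≉0))

  x*[x⁻¹*y]≈y : ∀ {x} → ¬ x ≈ 0# → ∀ y → x * (x ⁻¹ * y) ≈ y
  x*[x⁻¹*y]≈y {x} x≉0 y =
    trans (sym (*-assoc x (x ⁻¹) y)) (trans (*-congʳ (*-inverseʳ x≉0)) (*-identityˡ y))

  x⁻¹*[x*y]≈y : ∀ {x} → ¬ x ≈ 0# → ∀ y → x ⁻¹ * (x * y) ≈ y
  x⁻¹*[x*y]≈y {x} x≉0 y =
    trans (sym (*-assoc (x ⁻¹) x y))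
      (trans (*-congʳ (trans (*-comm (x ⁻¹) x) (*-inverseʳ x≉0))) (*-identityˡ y))

  -- If either inequality were strict, the sums would differ. This is how a constraint tight for a
  -- sum of two feasible vectors becomes tight for each of them.
  +-squeezeˡ : ∀ {x y u v} → x ≤ᴿ u → y ≤ᴿ v → x + y ≈ u + v → x ≈ u
  +-squeezeˡ {x} {y} {u} {v} x≤u y≤v x+y≈u+v = antisym x≤u (+-cancelʳ-≤ v (begin
    u + v ≈⟨ x+y≈u+v ⟨
    x + y ≤⟨ +-monoʳ-≤ x y≤v ⟩
    x + v ∎))

  -- With its converse below, it trades "x is the multiple y z" for the vanishing of one coordinate
  -- of a combination `- t • w ⊕ v`, the form in which rigidity applies.
  x≈yz⇒-yz+x≈0 : ∀ {x y z} → x ≈ y * z → - y * z + x ≈ 0#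
  x≈yz⇒-yz+x≈0 {x} {y} {z} x≈yz =
    trans (+-cong (sym (-‿distribˡ-* y z)) x≈yz) (-‿inverseˡ (y * z))

  -yz+x≈0⇒x≈yz : ∀ {x y z} → - y * z + x ≈ 0# → x ≈ y * z
  -yz+x≈0⇒x≈yz {x} {y} {z} p =
    trans (+-inverseʳ-unique _ _ p) (trans (-‿cong (sym (-‿distribˡ-* y z))) (-‿involutive _))

-- Linear functionals and kernels of finite systems.

module LinearFunctionals {c ℓ₁ ℓ₂} (ℝ : RealField c ℓ₁ ℓ₂) where
  open RealField ℝ hiding (zero)
  open OrderedField ℝ
  open Rays ℝ
  open ≤-Reasoning

  private variable X Y : Set

  infix 4 _≋_
  _≋_ : Vect X → Vect X → Set ℓ₁
  x ≋ y = ∀ k → x k ≈ y k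

  𝟎 : Vect X
  𝟎 _ = 0#

  infixr 7 _•_⊕_
  -- Scaling and addition fused into one operation, so that linearity is a single equation.
  _•_⊕_ : Carrier → Vect X → Vect X → Vect X
  (a • x ⊕ y) k = a * x k + y k

  record Linear (X : Set) : Set (c ⊔ ℓ₁) where
    field
      ⟦_⟧     : Vect X → Carrier
      ⟦⟧-cong : ∀ {x y} → x ≋ y → ⟦_⟧ x ≈ ⟦_⟧ y
      linear  : ∀ a x y → ⟦_⟧ (a • x ⊕ y) ≈ a * ⟦_⟧ x + ⟦_⟧ y

    ⟦𝟎⟧≈0 : ∀ {x} → x ≋ 𝟎 → ⟦_⟧ x ≈ 0#
    ⟦𝟎⟧≈0 {x} x≋𝟎 = begin-equality
      -- A zero vector x is also `- 1# • x ⊕ x`, whose image cancels by linearity.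
      ⟦_⟧ x                   ≈⟨ ⟦⟧-cong (λ k → trans (x≋𝟎 k) (sym (-1*x+x≈0 (x k)))) ⟩
      ⟦_⟧ (- 1# • x ⊕ x)      ≈⟨ linear (- 1#) x x ⟩
      - 1# * ⟦_⟧ x + ⟦_⟧ x    ≈⟨ -1*x+x≈0 (⟦_⟧ x) ⟩
      0#                      ∎
      where
      -1*x+x≈0 : ∀ x → - 1# * x + x ≈ 0#
      -1*x+x≈0 x = trans (+-congʳ (-1*x≈-x x)) (-‿inverseˡ x)

    ⟦⟧-scale : ∀ a x → ⟦_⟧ (λ k → a * x k) ≈ a * ⟦_⟧ x
    ⟦⟧-scale a x = begin-equality
      ⟦_⟧ (λ k → a * x k)   ≈⟨ ⟦⟧-cong (λ k → sym (+-identityʳ (a * x k))) ⟩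
      ⟦_⟧ (a • x ⊕ 𝟎)       ≈⟨ linear a x 𝟎 ⟩
      a * ⟦_⟧ x + ⟦_⟧ 𝟎     ≈⟨ +-congˡ (⟦𝟎⟧≈0 (λ _ → refl)) ⟩
      a * ⟦_⟧ x + 0#        ≈⟨ +-identityʳ _ ⟩
      a * ⟦_⟧ x             ∎

    ⟦⟧-+ : ∀ x y → ⟦_⟧ (λ k → x k + y k) ≈ ⟦_⟧ x + ⟦_⟧ y
    ⟦⟧-+ x y = begin-equality
      ⟦_⟧ (λ k → x k + y k)  ≈⟨ ⟦⟧-cong (λ k → +-congʳ (sym (*-identityˡ (x k)))) ⟩
      ⟦_⟧ (1# • x ⊕ y)       ≈⟨ linear 1# x y ⟩
      1# * ⟦_⟧ x + ⟦_⟧ y     ≈⟨ +-congʳ (*-identityˡ _) ⟩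
      ⟦_⟧ x + ⟦_⟧ y          ∎

  open Linear public

  coordinate : X → Linear X
  coordinate k = record { ⟦_⟧ = λ x → x k ; ⟦⟧-cong = λ x≋y → x≋y k ; linear = λ _ _ _ → refl }

  -- A linear map, given by its coordinate functionals.
  pullback : (Y → Linear X) → Linear Y → Linear X
  pullback σ f = record
    { ⟦_⟧     = λ x → ⟦ f ⟧ (λ k → ⟦ σ k ⟧ x)
    ; ⟦⟧-cong = λ x≋y → ⟦⟧-cong f (λ k → ⟦⟧-cong (σ k) x≋y)
    ; linear  = λ a x y → trans (⟦⟧-cong f (λ k → linear (σ k) a x y)) (linear f a _ _)
    }

  Vanishes : List (Linear X) → Vect X → Set (c ⊔ ℓ₁)
  Vanishes fs d = All (λ f → ⟦ f ⟧ d ≈ 0#) fs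

  e₀ : ∀ {k} → Vect (Fin (ℕ.suc k))
  e₀ zero    = 1#
  e₀ (suc _) = 0#

  infixr 5 _◂_
  _◂_ : ∀ {k} → Carrier → Vect (Fin k) → Vect (Fin (ℕ.suc k))
  (a ◂ d) zero    = a
  (a ◂ d) (suc i) = d i

  -- Solves f d = 0 for the coordinate d₀, given that the coefficient f e₀ is nonzero.
  module Elimination {k} (f : Linear (Fin (ℕ.suc k))) (fe₀≉0 : ¬ ⟦ f ⟧ e₀ ≈ 0#) where

    eliminated : Vect (Fin k) → Carrier
    eliminated d = - ⟦ f ⟧ e₀ ⁻¹ * ⟦ f ⟧ (0# ◂ d)

    -- The parametrization of the hyperplane f d = 0 by the remaining coordinates. Its coordinates
    -- are functionals, so that `pullback` can substitute it into the other equations.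
    eliminate : Fin (ℕ.suc k) → Linear (Fin k)
    eliminate zero = record
      { ⟦_⟧     = eliminated
      ; ⟦⟧-cong = λ x≋y → *-congˡ (⟦⟧-cong f λ { zero → refl ; (suc i) → x≋y i })
      ; linear  = λ a x y → begin-equality
          - ⟦ f ⟧ e₀ ⁻¹ * ⟦ f ⟧ (0# ◂ (a • x ⊕ y))
            ≈⟨ *-congˡ (⟦⟧-cong f λ { zero → sym (trans (+-identityʳ _) (zeroʳ a)) ; (suc i) → refl }) ⟩
          - ⟦ f ⟧ e₀ ⁻¹ * ⟦ f ⟧ (a • (0# ◂ x) ⊕ (0# ◂ y))
            ≈⟨ *-congˡ (linear f a _ _) ⟩
          - ⟦ f ⟧ e₀ ⁻¹ * (a * ⟦ f ⟧ (0# ◂ x) + ⟦ f ⟧ (0# ◂ y))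
            ≈⟨ distribˡ _ _ _ ⟩
          - ⟦ f ⟧ e₀ ⁻¹ * (a * ⟦ f ⟧ (0# ◂ x)) + eliminated y
            ≈⟨ +-congʳ (trans (sym (*-assoc _ _ _)) (trans (*-congʳ (*-comm _ _)) (*-assoc _ _ _))) ⟩
          a * eliminated x + eliminated y ∎
      }
    eliminate (suc i) = coordinate i

    solution : Vect (Fin k) → Vect (Fin (ℕ.suc k))
    solution d i = ⟦ eliminate i ⟧ d

    solve-unique : ∀ d → ⟦ f ⟧ d ≈ 0# → d ≋ solution (d ∘ suc)
    solve-unique d fd≈0 (suc i) = refl
    solve-unique d fd≈0 zero = begin-equality
      d zero
        ≈⟨ x⁻¹*[x*y]≈y fe₀≉0 (d zero) ⟨
      ⟦ f ⟧ e₀ ⁻¹ * (⟦ f ⟧ e₀ * d zero)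
        ≈⟨ *-congˡ (*-comm _ _) ⟩
      ⟦ f ⟧ e₀ ⁻¹ * (d zero * ⟦ f ⟧ e₀)
        ≈⟨ *-congˡ (+-inverseˡ-unique _ _ d₀fe₀+fd≈0) ⟩
      ⟦ f ⟧ e₀ ⁻¹ * - ⟦ f ⟧ (0# ◂ (d ∘ suc))
        ≈⟨ trans (sym (-‿distribʳ-* _ _)) (-‿distribˡ-* _ _) ⟩
      eliminated (d ∘ suc) ∎
      where
      d₀fe₀+fd≈0 : d zero * ⟦ f ⟧ e₀ + ⟦ f ⟧ (0# ◂ (d ∘ suc)) ≈ 0#
      d₀fe₀+fd≈0 = begin-equality
        d zero * ⟦ f ⟧ e₀ + ⟦ f ⟧ (0# ◂ (d ∘ suc)) ≈⟨ linear f _ _ _ ⟨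
        ⟦ f ⟧ (d zero • e₀ ⊕ (0# ◂ (d ∘ suc)))
          ≈⟨ ⟦⟧-cong f (λ { zero    → trans (+-identityʳ _) (*-identityʳ _)
                          ; (suc i) → trans (+-congʳ (zeroʳ _)) (+-identityˡ _) }) ⟩
        ⟦ f ⟧ d                                    ≈⟨ fd≈0 ⟩
        0#                                         ∎

  -- Gaussian elimination, one variable per recursive call. If no functional involves the first
  -- variable, `e₀` lies in the kernel; otherwise a functional that does serves as pivot.
  nontrivialKernel? : ∀ {k} (fs : List (Linear (Fin k))) →
    (∃[ d ] (¬ d ≋ 𝟎 × Vanishes fs d)) ⊎ (∀ d → Vanishes fs d → d ≋ 𝟎)
  nontrivialKernel? {ℕ.zero}  fs = inj₂ λ _ _ ()
  nontrivialKernel? {ℕ.suc k} fs with Any.any? (λ f → ¬? (⟦ f ⟧ e₀ ≟ 0#)) fs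
  ... | no ∀fe₀≈0 =
    inj₁ (e₀ , (λ e₀≋𝟎 → 0≉1 (sym (e₀≋𝟎 zero))) ,
          All.map (decidable-stable (_ ≟ 0#)) (All.¬Any⇒All¬ fs ∀fe₀≈0))
  ... | yes ∃fe₀≉0 with f , f∈fs , fe₀≉0 ← find ∃fe₀≉0
                   -- The pivot f stays in the list: its pullback is identically zero, and a kernel
                   -- vector of the reduced system thus lifts to one that annihilates f too.
                   with nontrivialKernel? (map (pullback (Elimination.eliminate f fe₀≉0)) fs)
  ...   | inj₁ (d , d≉𝟎 , fs[d]≈0) =
    inj₁ (solution d , (λ sol≋𝟎 → d≉𝟎 (λ i → sol≋𝟎 (suc i))) , All.map⁻ fs[d]≈0)
    where open Elimination f fe₀≉0
  ...   | inj₂ trivial = inj₂ λ d fs[d]≈0 →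
    let d≋sol = solve-unique d (All.lookup fs[d]≈0 f∈fs)
        d≈0   = trivial (d ∘ suc) (All.map⁺ (All.map
                  (λ {g} gd≈0 → trans (⟦⟧-cong g (λ i → sym (d≋sol i))) gd≈0) fs[d]≈0))
    in λ { zero    → trans (d≋sol zero) (⟦𝟎⟧≈0 (eliminate zero) d≈0)
         ; (suc i) → d≈0 i }
    where open Elimination f fe₀≉0


-- Walking to a vertex of a polyhedron.

module Vertices {c ℓ₁ ℓ₂} (ℝ : RealField c ℓ₁ ℓ₂) where
  open RealField ℝ hiding (zero)
  open OrderedField ℝ
  open LinearFunctionals ℝ
  open Rays ℝ
  open ≤-Reasoning

  module _ {k} {C : Set} (f : C → Linear (Fin k)) (b : C → Carrier) (cs : List C) where

    Feasible : Vect (Fin k) → Set ℓ₂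
    Feasible x = ∀ {j} → j ∈ cs → b j ≤ᴿ ⟦ f j ⟧ x

    Tight : Vect (Fin k) → C → Set ℓ₁
    Tight x j = ⟦ f j ⟧ x ≈ b j

    tight? : ∀ x j → Dec (Tight x j)
    tight? x j = ⟦ f j ⟧ x ≟ b j

    -- The ratio test of the simplex method. Moving from x along d keeps tight constraints tight,
    -- and the admissible step length is the least quotient of slack by rate of decrease over the
    -- decreasing constraints.
    module RatioTest (x : Vect (Fin k)) (feasible : Feasible x)
                     (d : Vect (Fin k)) (flat : ∀ {j} → j ∈ cs → Tight x j → ⟦ f j ⟧ d ≈ 0#)
                     {i : C} (i∈cs : i ∈ cs) (slope<0 : ⟦ f i ⟧ d <ᴿ 0#) where

      Decreasing : C → Set (ℓ₁ ⊔ ℓ₂)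
      Decreasing j = ⟦ f j ⟧ d <ᴿ 0#

      decreasing? : ∀ j → Dec (Decreasing j)
      decreasing? j = (⟦ f j ⟧ d ≤? 0#) ×-dec ¬? (⟦ f j ⟧ d ≟ 0#)

      ¬Decreasing⇒0≤ : ∀ {j} → ¬ Decreasing j → 0# ≤ᴿ ⟦ f j ⟧ d
      ¬Decreasing⇒0≤ {j} ¬dec with total 0# (⟦ f j ⟧ d) | ⟦ f j ⟧ d ≟ 0#
      ... | inj₁ 0≤s | _        = 0≤s
      ... | inj₂ s≤0 | yes s≈0  = ≤-reflexive (sym s≈0)
      ... | inj₂ s≤0 | no s≉0   = contradiction (s≤0 , s≉0) ¬dec

      slack : C → Carrier
      slack j = ⟦ f j ⟧ x - b j

      ratio : C → Carrier
      ratio j = (- ⟦ f j ⟧ d) ⁻¹ * slack j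

      ratio-exact : ∀ {j} → Decreasing j → ⟦ f j ⟧ d * ratio j + ⟦ f j ⟧ x ≈ b j
      ratio-exact {j} (_ , s≉0) = begin-equality
        s * ratio j + fx       ≈⟨ +-congʳ (trans (sym (-‿involutive _)) (-‿cong (-‿distribˡ-* s _))) ⟩
        - (- s * ratio j) + fx ≈⟨ +-congʳ (-‿cong (x*[x⁻¹*y]≈y -s≉0 (slack j))) ⟩
        - (fx - b j) + fx      ≈⟨ +-congʳ (⁻¹-anti-homo‿- fx (b j)) ⟩
        b j - fx + fx          ≈⟨ x-y+y≈x (b j) fx ⟩
        b j                    ∎
        where
        s fx : Carrier
        s = ⟦ f j ⟧ d
        fx = ⟦ f j ⟧ x
        -s≉0 : ¬ - s ≈ 0#
        -s≉0 -s≈0 = s≉0 (trans (sym (-‿involutive s)) (trans (-‿cong -s≈0) -0#≈0#))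

      candidates : List C
      candidates = filter decreasing? cs

      -- The default i is itself a decreasing constraint, so the minimizer is one without a proof
      -- that the candidate list is nonempty.
      i⋆ : C
      i⋆ = argmin ratio i candidates

      i⋆-decreasing : i⋆ ∈ cs × Decreasing i⋆
      i⋆-decreasing = argmin-all ratio {P = λ j → j ∈ cs × Decreasing j} (i∈cs , slope<0)
        (All.tabulate (∈-filter⁻ decreasing? {xs = cs}))

      t : Carrier
      t = ratio i⋆

      0≤t : 0# ≤ᴿ t
      0≤t = *-nonneg (⁻¹-nonneg (x≤0⇒0≤-x (proj₁ (proj₂ i⋆-decreasing))))
                     (x≤y⇒0≤y-x (feasible (proj₁ i⋆-decreasing)))

      x′ : Vect (Fin k)
      x′ = t • d ⊕ x

      value : ∀ j → ⟦ f j ⟧ x′ ≈ ⟦ f j ⟧ d * t + ⟦ f j ⟧ x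
      value j = trans (linear (f j) t d x) (+-congʳ (*-comm t _))

      -- A decreasing constraint fails only beyond its own ratio, and t is the least ratio. Any
      -- other constraint cannot fail after a nonnegative step.
      x′-feasible : Feasible x′
      x′-feasible {j} j∈cs with decreasing? j
      ... | yes dec = begin
        b j                           ≈⟨ ratio-exact dec ⟨
        ⟦ f j ⟧ d * ratio j + ⟦ f j ⟧ x ≤⟨ +-monoˡ-≤ _ (*-antimonoˡ-≤-nonpos (proj₁ dec) t≤ratio) ⟩
        ⟦ f j ⟧ d * t + ⟦ f j ⟧ x       ≈⟨ value j ⟨
        ⟦ f j ⟧ x′                      ∎
        where
        t≤ratio : t ≤ᴿ ratio j
        t≤ratio = All.lookup (f[argmin]≤f[xs] {f = ratio} i candidates) (∈-filter⁺ decreasing? j∈cs dec)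
      ... | no ¬dec = begin
        b j                       ≤⟨ feasible j∈cs ⟩
        ⟦ f j ⟧ x                 ≈⟨ +-identityˡ _ ⟨
        0# + ⟦ f j ⟧ x            ≤⟨ +-monoˡ-≤ _ (*-nonneg (¬Decreasing⇒0≤ ¬dec) 0≤t) ⟩
        ⟦ f j ⟧ d * t + ⟦ f j ⟧ x ≈⟨ value j ⟨
        ⟦ f j ⟧ x′                ∎

      still-tight : ∀ {j} → j ∈ cs → Tight x j → Tight x′ j
      still-tight {j} j∈cs tight = begin-equality
        ⟦ f j ⟧ x′                ≈⟨ value j ⟩
        ⟦ f j ⟧ d * t + ⟦ f j ⟧ x ≈⟨ +-congʳ (trans (*-congʳ (flat j∈cs tight)) (zeroˡ t)) ⟩
        0# + ⟦ f j ⟧ x            ≈⟨ +-identityˡ _ ⟩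
        ⟦ f j ⟧ x                 ≈⟨ tight ⟩
        b j                       ∎

      newly-tight : ∃[ j ] (j ∈ cs × ¬ Tight x j × Tight x′ j)
      newly-tight = i⋆ , proj₁ i⋆-decreasing
        -- Had `i⋆` been tight at x, its slope along d would be zero, not negative.
        , (λ tight → proj₂ (proj₂ i⋆-decreasing) (flat (proj₁ i⋆-decreasing) tight))
        , trans (value i⋆) (ratio-exact (proj₂ i⋆-decreasing))

    -- The lineality space is zero, so a nonempty polyhedron contains no line.
    Pointed : Set (c ⊔ ℓ₁)
    Pointed = ∀ d → (∀ {j} → j ∈ cs → ⟦ f j ⟧ d ≈ 0#) → d ≋ 𝟎

    IsVertex : Vect (Fin k) → Set (c ⊔ ℓ₁)
    IsVertex x = ∀ d → (∀ {j} → j ∈ cs → Tight x j → ⟦ f j ⟧ d ≈ 0#) → d ≋ 𝟎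

    -- By pointedness some functional is nonzero at d. Either d or its negative makes it negative,
    -- and both are annihilated by the same functionals.
    descentDirection : Pointed →
      ∀ (Q : C → Set ℓ₁) d → ¬ d ≋ 𝟎 → (∀ {j} → j ∈ cs → Q j → ⟦ f j ⟧ d ≈ 0#) →
      ∃[ d′ ] ((∀ {j} → j ∈ cs → Q j → ⟦ f j ⟧ d′ ≈ 0#) ×
               ∃[ i ] (i ∈ cs × ⟦ f i ⟧ d′ <ᴿ 0#))
    descentDirection pointed Q d d≉𝟎 flat with Any.any? (λ j → ¬? (⟦ f j ⟧ d ≟ 0#)) cs
    ... | no all≈0 = contradiction
      (pointed d (λ j∈cs → decidable-stable (_ ≟ 0#) (All.lookup (All.¬Any⇒All¬ cs all≈0) j∈cs))) d≉𝟎
    ... | yes some≉0 with i , i∈cs , s≉0 ← find some≉0 with total 0# (⟦ f i ⟧ d)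
    ...   | inj₂ s≤0 = d , flat , i , i∈cs , s≤0 , s≉0
    ...   | inj₁ 0≤s = (λ l → - 1# * d l) ,
      (λ {j} j∈cs q → trans (negated j) (trans (-‿cong (flat j∈cs q)) -0#≈0#)) ,
      i , i∈cs , (begin
        ⟦ f i ⟧ (λ l → - 1# * d l) ≈⟨ negated i ⟩
        - ⟦ f i ⟧ d                ≤⟨ neg-antimono-≤ 0≤s ⟩
        - 0#                       ≈⟨ -0#≈0# ⟩
        0#                         ∎) ,
      (λ -s≈0 → s≉0 (trans (sym (-‿involutive _))
                   (trans (-‿cong (trans (sym (negated i)) -s≈0)) -0#≈0#)))
      where
      negated : ∀ j → ⟦ f j ⟧ (λ l → - 1# * d l) ≈ - ⟦ f j ⟧ d
      negated j = trans (⟦⟧-scale (f j) (- 1#) d) (-1*x≈-x _)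

    -- Every constraint that is not tight at x is listed in U, whose length is the measure.
    reachVertex : Pointed →
      ∀ m x U → length U < m → Feasible x → (∀ {j} → j ∈ cs → Tight x j ⊎ j ∈ U) →
      ∃[ x′ ] (Feasible x′ × (∀ {j} → j ∈ cs → Tight x j → Tight x′ j) × IsVertex x′)
    reachVertex pointed (ℕ.suc m) x U (s≤s ∣U∣≤m) feasible covered
      with nontrivialKernel? (map f (filter (tight? x) cs))
    ... | inj₂ trivial = x , feasible , (λ _ tight → tight) ,
      λ d flat → trivial d (All.map⁺ (All.tabulate λ j∈ →
        let j∈cs , tight = ∈-filter⁻ (tight? x) {xs = cs} j∈ in flat j∈cs tight))
    ... | inj₁ (d , d≉𝟎 , vanishes)
      with d′ , flat , i , i∈cs , slope<0 ←
             descentDirection pointed (Tight x) d d≉𝟎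
               (λ j∈cs tight → All.lookup (All.map⁻ vanishes) (∈-filter⁺ (tight? x) j∈cs tight)) =
      let open RatioTest x feasible d′ flat i∈cs slope<0
          j , j∈cs , ¬tight , tight′ = newly-tight
          j∈U = fromInj₂ (λ tight → contradiction tight ¬tight) (covered j∈cs)
          slack? = λ j → ¬? (tight? x′ j)
          x″ , feasible″ , tight″ , vertex″ =
            reachVertex pointed m x′ (filter slack? U)
              -- The measure drops: j was not tight at x, hence is listed in U, and the filter
              -- discards it because it is tight at `x′`.
              (ℕ.≤-trans (filter-notAll slack? U (lose j∈U λ ¬tight′ → ¬tight′ tight′)) ∣U∣≤m)
              x′-feasible
              (λ {l} l∈cs → case tight? x′ l of λ where
                (yes l-tight′) → inj₁ l-tight′
                (no ¬l-tight′) → inj₂ (∈-filter⁺ slack?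
                  (fromInj₂ (λ l-tight → contradiction (still-tight l∈cs l-tight) ¬l-tight′)
                            (covered l∈cs)) ¬l-tight′))
      in x″ , feasible″ , (λ l∈cs l-tight → tight″ l∈cs (still-tight l∈cs l-tight)) , vertex″

-- Enumeration of vertex sets, and terminal sets.

subsets : ∀ m → List (Subset m)
subsets ℕ.zero    = [] ∷ []
subsets (ℕ.suc m) = cartesianProductWith _∷_ (inside ∷ outside ∷ []) (subsets m)

∈-subsets : ∀ {m} (W : Subset m) → W ∈ subsets m
∈-subsets []      = here ≡.refl
∈-subsets (b ∷ W) = ∈-cartesianProductWith⁺ _∷_ (∈-sides b) (∈-subsets W)
  where
  ∈-sides : ∀ b → b ∈ inside ∷ outside ∷ []
  ∈-sides true  = here ≡.refl
  ∈-sides false = there (here ≡.refl)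

∈-initial⁻ : ∀ {N m} {v : Fin N} → v ∈ˢ initial m → toℕ v < m
∈-initial⁻ {m = m} {v} v∈ = ℕ.<ᵇ⇒< (toℕ v) m
  (≡.subst T (≡.trans (≡.sym ([]=⇒lookup v∈)) (lookup∘tabulate _ v)) tt)

∈-initial⁺ : ∀ {N m} {v : Fin N} → toℕ v < m → v ∈ˢ initial m
∈-initial⁺ {m = m} {v} v<m =
  lookup⇒[]= v _ (≡.trans (lookup∘tabulate _ v) (dec-true (toℕ v ℕ.<? m) v<m))

initial-mono : ∀ {N m n} → m ≤ n → initial {N} m ⊆ initial n
initial-mono m≤n v∈ = ∈-initial⁺ (ℕ.<-≤-trans (∈-initial⁻ v∈) m≤n)

p⊆q⇒p∩q≡p : ∀ {m} {p q : Subset m} → p ⊆ q → p ∩ q ≡ p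
p⊆q⇒p∩q≡p {p = p} {q} p⊆q = ⊆-antisym (p∩q⊆p p q) (λ x∈p → x∈p∩q⁺ (x∈p , p⊆q x∈p))

-- The remaining fields are irrelevant, so once the sets agree the records agree definitionally.
terminalSet-≡ : ∀ {N n} {I J : TerminalSet N n} → TerminalSet.set I ≡ TerminalSet.set J → I ≡ J
terminalSet-≡ ≡.refl = ≡.refl

-- Cut weights as linear functionals, and minimum cuts.

module CutCones {c ℓ₁ ℓ₂} (ℝ : RealField c ℓ₁ ℓ₂) (N n : ℕ) (n<N : n < N) where
  open RealField ℝ hiding (zero)
  open OrderedField ℝ
  open LinearFunctionals ℝ
  open Vertices ℝ
  open Cuts ℝ N n
  open Algebra.Properties.Semiring.Sum semiring
    using (sum-cong-≋; ∑-distrib-+; *-distribˡ-sum)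
  open ≤-Reasoning

  sum-linear : ∀ {m} a {x y z : Vect (Fin m)} → z ≋ a • x ⊕ y → sum z ≈ a * sum x + sum y
  sum-linear a {x} {y} z≋ =
    trans (sum-cong-≋ z≋) (trans (∑-distrib-+ _ y) (+-congʳ (sym (*-distribˡ-sum a x))))

  ∑∑-linear : ∀ {m} a {x y z : Fin m → Vect (Fin m)} → (∀ i → z i ≋ a • x i ⊕ y i) →
    sum (λ i → sum (z i)) ≈ a * sum (λ i → sum (x i)) + sum (λ i → sum (y i))
  ∑∑-linear a z≋ = sum-linear a λ i → sum-linear a (z≋ i)

  -- The summand of edgeSum is local to its definition; its name is recovered by unification
  -- from the use of term-linear.
  term-linear : ∀ a {x y z} → z ≋ a • x ⊕ y → ∀ i j → _

  edgeSum-linear : ∀ a {x y z} → z ≋ a • x ⊕ y → edgeSum z ≈ a * edgeSum x + edgeSum y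
  edgeSum-linear a z≋ = ∑∑-linear {N} a (term-linear a z≋)

  term-linear a z≋ i j with Fin._<?_ {N} {N} i j
  ... | yes i<j = z≋ (edge i j i<j)
  ... | no _    = sym (trans (+-identityʳ _) (zeroʳ a))

  edgeSumL : Linear (Edge N)
  edgeSumL = record
    { ⟦_⟧     = edgeSum
    -- Congruence is the case of coefficient zero: x ≋ y makes x equal to `0# • y ⊕ y`.
    ; ⟦⟧-cong = λ {x} {y} x≋y → trans
        (edgeSum-linear 0# {y} {y} λ e → trans (x≋y e) (sym (0*x+y≈y (y e) (y e))))
        (0*x+y≈y (edgeSum y) (edgeSum y))
    ; linear  = λ a x y → edgeSum-linear a λ _ → refl
    }
    where
    0*x+y≈y : ∀ x y → 0# * x + y ≈ y
    0*x+y≈y x y = trans (+-congʳ (zeroˡ x)) (+-identityˡ y)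

  Terminals : Set
  Terminals = TerminalSet N n

  -- All ordered pairs of vertices. The vertex search works on vectors over `Fin`, so weights are
  -- moved to these N² coordinates.
  Slot : Set
  Slot = Fin (N ℕ.* N)

  indicator : Bool → Edge N → Linear (Edge N)
  indicator b e = record
    { ⟦_⟧     = λ w → if b then w e else 0#
    ; ⟦⟧-cong = λ w≋v → indicator-cong b (w≋v e)
    ; linear  = λ a w v → indicator-linear b a (w e) (v e)
    }
    where
    indicator-cong : ∀ b {x y} → x ≈ y → (if b then x else 0#) ≈ (if b then y else 0#)
    indicator-cong true  x≈y = x≈y
    indicator-cong false _   = refl

    indicator-linear : ∀ b a x y → (if b then a * x + y else 0#) ≈
                                   a * (if b then x else 0#) + (if b then y else 0#)
    indicator-linear true  a x y = refl
    indicator-linear false a x y = sym (trans (+-identityʳ _) (zeroʳ a))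

  -- Built so that `⟦ cut W ⟧` unfolds to `∥C W ∥`; facts about linear functionals then apply to cut
  -- weights directly.
  cut : Subset N → Linear (Edge N)
  cut W = pullback crossing edgeSumL
    where
    crossing : Edge N → Linear (Edge N)
    crossing e = indicator (lookup W (Edge.source e) xor lookup W (Edge.target e)) e

  -- From n < N follows [n] ⊆ [N - 1], so a terminal set avoids the last vertex and every S_I is a
  -- minimum over a nonempty family.
  self-extends : ∀ I → Extends I (TerminalSet.set I)
  self-extends (terminalSet I _ I⊆[n]) =
    (λ v∈I → initial-mono (ℕ.<⇒≤pred n<N) (I⊆[n]′ v∈I)) , p⊆q⇒p∩q≡p I⊆[n]′
    where
    I⊆[n]′ : I ⊆ initial n
    -- The inclusion is an irrelevant field; decidability of ⊆ makes it usable again.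
    I⊆[n]′ = recompute (I ⊆? initial n) I⊆[n]

  extends? : ∀ I W → Dec (Extends I W)
  extends? I W = (W ⊆? initial (N ∸ 1)) ×-dec (≡-dec Bool._≟_ (W ∩ initial n) (TerminalSet.set I))

  minCut : ∀ w I → ∃[ W ] (Extends I W × (∀ W′ → Extends I W′ → ∥C W ∥ w ≤ᴿ ∥C W′ ∥ w))
  minCut w I =
    argmin weight I₀ candidates ,
    argmin-all weight (self-extends I) (All.tabulate (proj₂ ∘ ∈-filter⁻ (extends? I) {xs = subsets N})) ,
    λ W′ ext → All.lookup (f[argmin]≤f[xs] {f = weight} I₀ candidates)
                          (∈-filter⁺ (extends? I) (∈-subsets W′) ext)
    where
    weight : Subset N → Carrier
    weight W = ∥C W ∥ w
    I₀ : Subset N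
    I₀ = TerminalSet.set I
    candidates : List (Subset N)
    candidates = filter (extends? I) (subsets N)

  minValue : Vect (Edge N) → Vect Terminals
  minValue w I = ∥C proj₁ (minCut w I) ∥ w

  -- Realizable vectors.

  Realizable : Vect Terminals → Set _
  Realizable S = ∃[ w ] Realizes w S

  realizes : ∀ {w S} → Nonneg w →
    (∀ I W → Extends I W → S I ≤ᴿ ∥C W ∥ w) →
    (∀ I → ∃[ W ] (Extends I W × S I ≈ ∥C W ∥ w)) → Realizes w S
  realizes w≥0 S≤ S≈ = w≥0 , λ I → S≈ I , λ { x (W , ext , x≈) →
    ≤-trans (S≤ I W ext) (≤-reflexive (sym x≈)) }

  realizes-≤ : ∀ {w S} → Realizes w S → ∀ I W → Extends I W → S I ≤ᴿ ∥C W ∥ w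
  realizes-≤ (_ , min) I W ext = proj₂ (min I) _ (W , ext , refl)

  realizable-𝟎 : Realizable 𝟎
  realizable-𝟎 = 𝟎 , realizes (λ _ → ≤-refl)
    (λ I W _ → ≤-reflexive (sym (⟦𝟎⟧≈0 (cut W) λ _ → refl)))
    (λ I → TerminalSet.set I , self-extends I , sym (⟦𝟎⟧≈0 (cut (TerminalSet.set I)) λ _ → refl))

  realizable-scale : ∀ {a S T} → 0# ≤ᴿ a → Realizable S → (∀ I → T I ≈ a * S I) → Realizable T
  realizable-scale {a} {S} {T} 0≤a (w , real) T≈aS = (λ e → a * w e) , realizes
    (λ e → *-nonneg 0≤a (proj₁ real e))
    (λ I W ext → begin
      T I                     ≈⟨ T≈aS I ⟩
      a * S I                 ≤⟨ *-monoˡ-≤-nonneg 0≤a (realizes-≤ real I W ext) ⟩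
      a * ∥C W ∥ w            ≈⟨ ⟦⟧-scale (cut W) a w ⟨
      ∥C W ∥ (λ e → a * w e)  ∎)
    (λ I → let W , ext , S≈ = proj₁ (proj₂ real I) in
      W , ext , trans (T≈aS I) (trans (*-congˡ S≈) (sym (⟦⟧-scale (cut W) a w))))

  realizable⇒H : ∀ {S} → Realizable S → H S
  realizable⇒H {S} real = 1 , (λ _ → 1#) , (λ _ → S) ,
    (λ _ → 0≤1) , +-identityʳ 1# , (λ _ → real) ,
    λ I → sym (trans (+-identityʳ _) (*-identityˡ (S I)))

  -- Sums in H, and realizability of its extreme rays.

  two half : Carrier
  two = 1# + 1#
  half = two ⁻¹

  0≤two : 0# ≤ᴿ two
  0≤two = ≤-trans (≤-reflexive (sym (+-identityʳ 0#))) (+-mono-≤ 0≤1 0≤1)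

  two≉0 : ¬ two ≈ 0#
  two≉0 two≈0 = 1≰0 (begin
    1#      ≈⟨ +-identityʳ 1# ⟨
    1# + 0# ≤⟨ +-monoʳ-≤ 1# 0≤1 ⟩
    two     ≈⟨ two≈0 ⟩
    0#      ∎)

  half*two*x≈x : ∀ x → half * (two * x) ≈ x
  half*two*x≈x = x⁻¹*[x*y]≈y two≉0

  half+half≈1 : half + half ≈ 1#
  half+half≈1 = begin-equality
    half + half           ≈⟨ +-cong (*-identityˡ half) (*-identityˡ half) ⟨
    1# * half + 1# * half ≈⟨ distribʳ half 1# 1# ⟨
    two * half            ≈⟨ *-inverseʳ two≉0 ⟩
    1#                    ∎

  -- H is given as a convex hull only, so S + T is written as the midpoint of 2S and 2T; the doubled
  -- points remain realizable by scaling the weights.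
  H-+ : ∀ {S T U} → Realizable S → H T → (∀ I → U I ≈ S I + T I) → H U
  H-+ {S} {T} {U} S-real (m , t , p , t≥0 , ∑t≈1 , p-real , T≈) U≈ =
    ℕ.suc m , weights , points , weights≥0 , total-weight , points-real , U≈combination
    where
    weights : Fin (ℕ.suc m) → Carrier
    weights zero    = half
    weights (suc i) = half * t i

    points : Fin (ℕ.suc m) → Vect Terminals
    points zero    I = two * S I
    points (suc i) I = two * p i I

    weights≥0 : ∀ i → 0# ≤ᴿ weights i
    weights≥0 zero    = ⁻¹-nonneg 0≤two
    weights≥0 (suc i) = *-nonneg (⁻¹-nonneg 0≤two) (t≥0 i)

    total-weight : sum weights ≈ 1#
    total-weight = begin-equality
      half + sum (λ i → half * t i) ≈⟨ +-congˡ (*-distribˡ-sum half t) ⟨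
      half + half * sum t           ≈⟨ +-congˡ (trans (*-congˡ ∑t≈1) (*-identityʳ half)) ⟩
      half + half                   ≈⟨ half+half≈1 ⟩
      1#                            ∎

    points-real : ∀ i → Realizable (points i)
    points-real zero    = realizable-scale 0≤two S-real λ _ → refl
    points-real (suc i) = realizable-scale 0≤two (p-real i) λ _ → refl

    regroup : ∀ i I → half * t i * (two * p i I) ≈ t i * p i I
    regroup i I = begin-equality
      half * t i * (two * p i I)   ≈⟨ *-congʳ (*-comm half (t i)) ⟩
      t i * half * (two * p i I)   ≈⟨ *-assoc (t i) half _ ⟩
      t i * (half * (two * p i I)) ≈⟨ *-congˡ (half*two*x≈x (p i I)) ⟩
      t i * p i I                  ∎

    U≈combination : ∀ I → U I ≈ sum (λ i → weights i * points i I)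
    U≈combination I = begin-equality
      U I                                  ≈⟨ U≈ I ⟩
      S I + T I                            ≈⟨ +-cong (sym (half*two*x≈x (S I))) (T≈ I) ⟩
      half * (two * S I) + sum (λ i → t i * p i I)
        ≈⟨ +-congˡ (sum-cong-≋ λ i → sym (regroup i I)) ⟩
      sum (λ i → weights i * points i I)   ∎

  H-∑ : ∀ m (p : Fin m → Vect Terminals) → (∀ i → Realizable (p i)) → H (λ I → sum (λ i → p i I))
  H-∑ ℕ.zero    p real = realizable⇒H realizable-𝟎
  H-∑ (ℕ.suc m) p real = H-+ (real zero) (H-∑ m (p ∘ suc) (real ∘ suc)) λ _ → refl

  -- Extremality makes the first term t S. If t is nonzero, S is a multiple of a realizable vector;
  -- if t is zero, the term drops out. The terms cannot run out, because S is nonzero.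
  extreme-∑⇒realizable : ∀ {S} → ExtremeRay H S →
    ∀ m (p : Fin m → Vect Terminals) → (∀ i → Realizable (p i)) →
    (∀ I → S I ≈ sum (λ i → p i I)) → Realizable S
  extreme-∑⇒realizable (_ , S≉𝟎 , _) ℕ.zero p real S≈ = contradiction S≈ S≉𝟎
  extreme-∑⇒realizable ext@(_ , _ , face) (ℕ.suc m) p real S≈
    with face (p zero) _ (realizable⇒H (real zero)) (H-∑ m (p ∘ suc) (real ∘ suc)) (λ I → sym (S≈ I))
  ... | (t , 0≤t , p₀≈tS) , _ with t ≟ 0#
  ...   | no t≉0  = realizable-scale (⁻¹-nonneg 0≤t) (real zero)
    λ I → sym (trans (*-congˡ (p₀≈tS I)) (x⁻¹*[x*y]≈y t≉0 _))
  ...   | yes t≈0 = extreme-∑⇒realizable ext m (p ∘ suc) (real ∘ suc)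
    λ I → trans (S≈ I) (trans
      (+-congʳ (trans (p₀≈tS I) (trans (*-congʳ t≈0) (zeroˡ _)))) (+-identityˡ _))

  extreme⇒realizable : ∀ {S} → ExtremeRay H S → Realizable S
  extreme⇒realizable ext@((m , t , p , t≥0 , _ , p-real , S≈) , _) =
    extreme-∑⇒realizable ext m (λ i I → t i * p i I)
      (λ i → realizable-scale (t≥0 i) (p-real i) λ _ → refl) S≈

  -- The polyhedron of weights for a fixed S, and rigid realizations.

  entry : Vect (Edge N) → Fin N × Fin N → Carrier
  entry w (i , j) with i Fin.<? j
  ... | yes i<j = w (edge i j i<j)
  ... | no _    = 0#

  slot : Edge N → Slot
  slot (edge i j _) = combine i j

  extend : Vect (Edge N) → Vect Slot
  extend w s = entry w (remQuot N s)

  extend-slot : ∀ w e → extend w (slot e) ≡ w e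
  extend-slot w (edge i j i<j) =
    ≡.trans (≡.cong (entry w) (Fin.remQuot-combine i j)) entry-edge
    where
    entry-edge : entry w (i , j) ≡ w (edge i j i<j)
    entry-edge with i Fin.<? j
    ... | yes _   = ≡.refl
    ... | no i≮j  = contradiction-irr i<j i≮j

  extend-≈0 : ∀ w s → (∀ e → slot e ≡ s → w e ≈ 0#) → extend w s ≈ 0#
  extend-≈0 w s w≈0 = entry-≈0 (remQuot N s) (Fin.combine-remQuot {N} N s)
    where
    entry-≈0 : ∀ ij → uncurry combine ij ≡ s → entry w ij ≈ 0#
    entry-≈0 (i , j) ij≡s with i Fin.<? j
    ... | yes i<j = w≈0 (edge i j i<j) ij≡s
    ... | no _    = refl

  extend-nonneg : ∀ {w} → Nonneg w → ∀ s → 0# ≤ᴿ extend w s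
  extend-nonneg {w} w≥0 s = entry-nonneg (remQuot N s)
    where
    entry-nonneg : ∀ ij → 0# ≤ᴿ entry w ij
    entry-nonneg (i , j) with i Fin.<? j
    ... | yes i<j = w≥0 (edge i j i<j)
    ... | no _    = ≤-refl

  restrict : Edge N → Linear Slot
  restrict e = coordinate (slot e)

  Extension : Set
  Extension = ∃[ I ] ∃[ W ] Extends I W

  -- Slots of pairs i ≥ j carry no edge; the constraints x ≥ 0 include them.
  Constraint : Set
  Constraint = Extension ⊎ Slot

  functional : Constraint → Linear Slot
  functional (inj₁ (_ , W , _)) = pullback restrict (cut W)
  functional (inj₂ s)           = coordinate s

  bound : Vect Terminals → Constraint → Carrier
  bound S (inj₁ (I , _)) = S I
  bound S (inj₂ _)       = 0#

  -- A set W extends at most one terminal set, namely W ∩ [n].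
  extensionsBy : Subset N → List Extension
  extensionsBy W with W ⊆? initial (N ∸ 1) | nonempty? (W ∩ initial n)
  ... | yes W⊆ | yes ne = (terminalSet (W ∩ initial n) ne (p∩q⊆q W _) , W , W⊆ , ≡.refl) ∷ []
  ... | _      | _      = []

  constraints : List Constraint
  constraints = map inj₁ (concatMap extensionsBy (subsets N)) ++ map inj₂ (allFin (N ℕ.* N))

  -- The listed proof of `Extends I W` may differ from the given one, hence the existential. Neither
  -- `functional` nor `bound` depends on that proof.
  ∈-extensionsBy : ∀ I W → Extends I W → ∃[ ext ] (I , W , ext) ∈ extensionsBy W
  ∈-extensionsBy (terminalSet _ ne _) W (W⊆ , ≡.refl)
    with W ⊆? initial (N ∸ 1) | nonempty? (W ∩ initial n)
  ... | yes W⊆′ | yes _  = (W⊆′ , ≡.refl) , here ≡.refl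
  ... | no W⊈   | _      = ⊥-elim (W⊈ W⊆)
  ... | yes _   | no ¬ne = contradiction-irr ne ¬ne

  cut∈constraints : ∀ I W → Extends I W → ∃[ ext ] inj₁ (I , W , ext) ∈ constraints
  cut∈constraints I W ext =
    let ext′ , ∈by = ∈-extensionsBy I W ext
    in ext′ , ∈-++⁺ˡ (∈-map⁺ inj₁ (∈-concatMap⁺ extensionsBy (lose (∈-subsets W) ∈by)))

  slot∈constraints : ∀ s → inj₂ s ∈ constraints
  slot∈constraints s = ∈-++⁺ʳ _ (∈-map⁺ inj₂ (∈-allFin s))

  -- The vertex condition for the polyhedron ‖C(W)‖ ≥ S_I, w ≥ 0, expressed on edges instead of
  -- slots.
  Rigid : Vect Terminals → Vect (Edge N) → Set _
  Rigid S w = ∀ v →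
    (∀ I W → Extends I W → S I ≈ ∥C W ∥ w → ∥C W ∥ v ≈ 0#) →
    (∀ e → w e ≈ 0# → v e ≈ 0#) → v ≋ 𝟎

  -- Walk from w to a vertex. Cuts attaining S are tight at the start and stay tight, so the vertex
  -- still realizes S.
  rigidRealization : ∀ {w S} → Realizes w S → ∃[ w′ ] (Realizes w′ S × Rigid S w′)
  rigidRealization {w} {S} real =
    w′ , realizes (λ e → feasible (slot∈constraints (slot e))) S≤ S≈ , rigid
    where
    restrict-extend : ∀ v W → ⟦ pullback restrict (cut W) ⟧ (extend v) ≈ ∥C W ∥ v
    restrict-extend v W = ⟦⟧-cong (cut W) λ e → reflexive (extend-slot v e)

    pointed : Pointed functional (bound S) constraints
    -- The nonnegativity constraints alone already separate points.
    pointed d d≈0 s = d≈0 (slot∈constraints s)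

    start-feasible : Feasible functional (bound S) constraints (extend w)
    start-feasible {inj₂ s} _ = extend-nonneg (proj₁ real) s
    start-feasible {inj₁ (I , W , ext)} _ =
      ≤-trans (realizes-≤ real I W ext) (≤-reflexive (sym (restrict-extend w W)))

    reached : _
    -- All constraints are initially listed as possibly slack, so `inj₂` covers each of them.
    reached = reachVertex functional (bound S) constraints pointed _ (extend w) constraints
      ℕ.≤-refl start-feasible inj₂

    x : Vect Slot
    x = proj₁ reached

    w′ : Vect (Edge N)
    w′ e = x (slot e)

    feasible : Feasible functional (bound S) constraints x
    feasible = proj₁ (proj₂ reached)

    S≤ : ∀ I W → Extends I W → S I ≤ᴿ ∥C W ∥ w′
    S≤ I W ext = feasible (proj₂ (cut∈constraints I W ext))

    S≈ : ∀ I → ∃[ W ] (Extends I W × S I ≈ ∥C W ∥ w′)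
    S≈ I = let W , ext , S≈ = proj₁ (proj₂ real I) in
      W , ext , sym (proj₁ (proj₂ (proj₂ reached)) (proj₂ (cut∈constraints I W ext))
                      (trans (restrict-extend w W) (sym S≈)))

    rigid : Rigid S w′
    rigid v cuts≈0 edges≈0 e = trans (reflexive (≡.sym (extend-slot v e)))
      (proj₂ (proj₂ (proj₂ reached)) (extend v)
        (λ { {inj₁ (I , W , ext)} _ tight → trans (restrict-extend v W) (cuts≈0 I W ext (sym tight))
           -- A slot without an edge needs no hypothesis, as `extend v` is zero there by default.
           ; {inj₂ s} _ xs≈0 → extend-≈0 v s λ { e ≡.refl → edges≈0 e xs≈0 } })
        (slot e))

  -- Part (b): splittings of a rigid realization inside P.

  module _ {S w} (real : Realizes w S) where

    -- The cut inequality holds for y and for z, and adding the two gives an equality; so both are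
    -- equalities.
    tight-summand : ∀ y z → P y → P z → (∀ k → y k + z k ≈ [ S , w ] k) →
      ∀ I W → Extends I W → S I ≈ ∥C W ∥ w → y (inj₁ I) ≈ ∥C W ∥ (y ∘ inj₂)
    tight-summand y z Py Pz y+z≈ I W ext S≈ = +-squeezeˡ (proj₁ Py W I ext) (proj₁ Pz W I ext)
      (begin-equality
        y (inj₁ I) + z (inj₁ I)                    ≈⟨ y+z≈ (inj₁ I) ⟩
        S I                                        ≈⟨ S≈ ⟩
        ∥C W ∥ w                                   ≈⟨ ⟦⟧-cong (cut W) (λ e → sym (y+z≈ (inj₂ e))) ⟩
        ∥C W ∥ (λ e → y (inj₂ e) + z (inj₂ e))     ≈⟨ ⟦⟧-+ (cut W) (y ∘ inj₂) (z ∘ inj₂) ⟩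
        ∥C W ∥ (y ∘ inj₂) + ∥C W ∥ (z ∘ inj₂)      ∎)

    -- For each I, a cut of w attaining S_I is tight for y too, so the bound y_I is attained.
    summand-realizes : ∀ y z → P y → P z → (∀ k → y k + z k ≈ [ S , w ] k) →
      Realizes (y ∘ inj₂) (y ∘ inj₁)
    summand-realizes y z Py Pz y+z≈ = realizes (proj₂ Py) (λ I W → proj₁ Py W I)
      λ I → let W , ext , S≈ = proj₁ (proj₂ real I) in
        W , ext , tight-summand y z Py Pz y+z≈ I W ext S≈

    -- The weights of y minus t w are annihilated by every constraint tight at (S , w), so rigidity
    -- extends proportionality from S to the weights.
    rigid-summand : Rigid S w → ∀ y z → P y → P z → (∀ k → y k + z k ≈ [ S , w ] k) →
      IsNonnegMultipleOf S (y ∘ inj₁) → IsNonnegMultipleOf [ S , w ] y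
    rigid-summand rigid y z Py Pz y+z≈ (t , 0≤t , y≈tS) = t , 0≤t ,
      [ y≈tS , (λ e → -yz+x≈0⇒x≈yz (rigid (- t • w ⊕ (y ∘ inj₂)) cuts≈0 edges≈0 e)) ]
      where
      cuts≈0 : ∀ I W → Extends I W → S I ≈ ∥C W ∥ w → ∥C W ∥ (- t • w ⊕ (y ∘ inj₂)) ≈ 0#
      cuts≈0 I W ext S≈ = begin-equality
        ∥C W ∥ (- t • w ⊕ (y ∘ inj₂))         ≈⟨ linear (cut W) (- t) w (y ∘ inj₂) ⟩
        - t * ∥C W ∥ w + ∥C W ∥ (y ∘ inj₂)    ≈⟨ x≈yz⇒-yz+x≈0 (begin-equality
          ∥C W ∥ (y ∘ inj₂)                     ≈⟨ tight-summand y z Py Pz y+z≈ I W ext S≈ ⟨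
          y (inj₁ I)                            ≈⟨ y≈tS I ⟩
          t * S I                               ≈⟨ *-congˡ S≈ ⟩
          t * ∥C W ∥ w                          ∎) ⟩
        0#                                    ∎

      edges≈0 : ∀ e → w e ≈ 0# → - t * w e + y (inj₂ e) ≈ 0#
      edges≈0 e w≈0 = x≈yz⇒-yz+x≈0 (begin-equality
        -- Two nonnegative weights with sum w(e) = 0 both vanish.
        y (inj₂ e)  ≈⟨ +-squeezeˡ (proj₂ Py e) (proj₂ Pz e)
                         (trans (+-identityʳ 0#) (sym (trans (y+z≈ (inj₂ e)) w≈0))) ⟨
        0#          ≈⟨ zeroʳ t ⟨
        t * 0#      ≈⟨ *-congˡ w≈0 ⟨
        t * w e     ∎)

  rigid⇒nontrivialExtreme : ∀ {S w} → ExtremeRay H S → Realizes w S → Rigid S w →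
    NontrivialExtremeRay [ S , w ]
  rigid⇒nontrivialExtreme {S} {w} (_ , S≉𝟎 , face) real rigid =
    (((λ W I → realizes-≤ real I W) , proj₁ real) , (λ x≋𝟎 → S≉𝟎 (x≋𝟎 ∘ inj₁)) , decompose) , nontrivial
    where
    decompose : ∀ y z → P y → P z → (∀ k → y k + z k ≈ [ S , w ] k) →
      IsNonnegMultipleOf [ S , w ] y × IsNonnegMultipleOf [ S , w ] z
    decompose y z Py Pz y+z≈ =
      let z+y≈ = λ k → trans (+-comm (z k) (y k)) (y+z≈ k)
          yS , zS = face (y ∘ inj₁) (z ∘ inj₁)
            (realizable⇒H (_ , summand-realizes real y z Py Pz y+z≈))
            (realizable⇒H (_ , summand-realizes real z y Pz Py z+y≈)) (y+z≈ ∘ inj₁)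
      in rigid-summand real rigid y z Py Pz y+z≈ yS , rigid-summand real rigid z y Pz Py z+y≈ zS

    -- A ray supported on an edge would have S = 0. A ray supported at S_I would have w = 0, but
    -- then S_I is a cut weight equal to 0 and not negative.
    nontrivial : ¬ Trivial [ S , w ]
    nontrivial (t , (_ , 0≉t) , inj₂ (e , _ , others≈0)) =
      S≉𝟎 λ I → *-cancelˡ-≈0 (0≉t ∘ sym) (others≈0 (inj₁ I) λ ())
    nontrivial (t , (_ , 0≉t) , inj₁ (I , tS≈-1 , others≈0)) =
      let W , _ , S≈ = proj₁ (proj₂ real I)
          w≋𝟎 = λ e → *-cancelˡ-≈0 (0≉t ∘ sym) (others≈0 (inj₂ e) λ ())
          S≈0 = trans S≈ (⟦𝟎⟧≈0 (cut W) w≋𝟎)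
      in 0≰-1 (≤-reflexive (trans (sym (zeroʳ t)) (trans (*-congˡ (sym S≈0)) tS≈-1)))

  extreme⇒nontrivialExtreme : ∀ S → ExtremeRay H S → ∃[ w ] NontrivialExtremeRay [ S , w ]
  extreme⇒nontrivialExtreme S ext =
    let _ , real           = extreme⇒realizable ext
        w , real′ , rigid  = rigidRealization real
    in w , rigid⇒nontrivialExtreme ext real′ rigid

  -- Part (a): nontrivial extreme rays of P give points of H.

  keep drop : ∀ {a} {A : Set a} → Dec A → Carrier → Carrier
  keep (yes _) x = x
  keep (no _)  _ = 0#
  drop (yes _) _ = 0#
  drop (no _)  x = x

  keep+drop : ∀ {a} {A : Set a} (d : Dec A) x → keep d x + drop d x ≈ x
  keep+drop (yes _) x = +-identityʳ x
  keep+drop (no _)  x = +-identityˡ x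

  keep-≤0 : ∀ {a} {A : Set a} (d : Dec A) {x} → x ≤ᴿ 0# → keep d x ≤ᴿ 0#
  keep-≤0 (yes _) x≤0 = x≤0
  keep-≤0 (no _)  _   = ≤-refl

  drop-≤0 : ∀ {a} {A : Set a} (d : Dec A) {x} → x ≤ᴿ 0# → drop d x ≤ᴿ 0#
  drop-≤0 (yes _) _   = ≤-refl
  drop-≤0 (no _)  x≤0 = x≤0

  ≤0⇒P : ∀ {S} → (∀ I → S I ≤ᴿ 0#) → P [ S , 𝟎 ]
  ≤0⇒P S≤0 = (λ W I _ → ≤-trans (S≤0 I) (≤-reflexive (sym (⟦𝟎⟧≈0 (cut W) λ _ → refl)))) , λ _ → ≤-refl

  -- Split off the coordinate at I. Both pieces are nonpositive with zero weights, hence in P. The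
  -- piece at I is then t S with t nonzero, so S vanishes at all other terminal sets.
  negative⇒trivial : ∀ {S w} → ExtremeRay P [ S , w ] → w ≋ 𝟎 → (∀ I → S I ≤ᴿ 0#) →
    ∀ I → ¬ S I ≈ 0# → Trivial [ S , w ]
  negative⇒trivial {S} {w} (_ , _ , face) w≋𝟎 S≤0 I S≉0 =
    scale , (⁻¹-nonneg (x≤0⇒0≤-x (S≤0 I)) , scale≉0 ∘ sym) , inj₁ (I , at-I , elsewhere)
    where
    same? : ∀ J → Dec (TerminalSet.set J ≡ TerminalSet.set I)
    same? J = ≡-dec Bool._≟_ (TerminalSet.set J) (TerminalSet.set I)

    summand : IsNonnegMultipleOf [ S , w ] [ (λ J → keep (same? J) (S J)) , 𝟎 ]
    summand = proj₁ (face [ (λ J → keep (same? J) (S J)) , 𝟎 ] [ (λ J → drop (same? J) (S J)) , 𝟎 ]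
      (≤0⇒P λ J → keep-≤0 (same? J) (S≤0 J)) (≤0⇒P λ J → drop-≤0 (same? J) (S≤0 J))
      [ (λ J → keep+drop (same? J) (S J)) , (λ e → trans (+-identityʳ 0#) (sym (w≋𝟎 e))) ])

    t : Carrier
    t = proj₁ summand

    keep≈tS : ∀ J → keep (same? J) (S J) ≈ t * S J
    keep≈tS J = proj₂ (proj₂ summand) (inj₁ J)

    t≉0 : ¬ t ≈ 0#
    t≉0 t≈0 with same? I | keep≈tS I
    ... | yes _  | S≈tS = S≉0 (trans S≈tS (trans (*-congʳ t≈0) (zeroˡ _)))
    ... | no I≢I | _    = I≢I ≡.refl

    S-elsewhere : ∀ J → J ≢ I → S J ≈ 0#
    S-elsewhere J J≢I with same? J | keep≈tS J
    ... | yes J≡I | _    = contradiction (terminalSet-≡ J≡I) J≢I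
    ... | no _    | 0≈tS = *-cancelˡ-≈0 t≉0 (sym 0≈tS)

    -S≉0 : ¬ - S I ≈ 0#
    -S≉0 -S≈0 = S≉0 (trans (sym (-‿involutive _)) (trans (-‿cong -S≈0) -0#≈0#))

    -- Chosen to normalize the negative coordinate S_I to -1.
    scale : Carrier
    scale = (- S I) ⁻¹

    scale≉0 : ¬ scale ≈ 0#
    scale≉0 = *≈1⇒≉0 (*-inverseʳ -S≉0)

    at-I : scale * S I ≈ - 1#
    at-I = begin-equality
      scale * S I       ≈⟨ *-congˡ (-‿involutive (S I)) ⟨
      scale * - - S I   ≈⟨ -‿distribʳ-* scale (- S I) ⟨
      - (scale * - S I) ≈⟨ -‿cong (trans (*-comm _ _) (*-inverseʳ -S≉0)) ⟩
      - 1#              ∎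

    elsewhere : ∀ k → k ≢ inj₁ I → scale * [ S , w ] k ≈ 0#
    elsewhere (inj₁ J) J≢I = trans (*-congˡ (S-elsewhere J (J≢I ∘ ≡.cong inj₁))) (zeroʳ scale)
    elsewhere (inj₂ e) _   = trans (*-congˡ (w≋𝟎 e)) (zeroʳ scale)

  nontrivialExtreme⇒H : ∀ S w → NontrivialExtremeRay [ S , w ] → H S
  nontrivialExtreme⇒H S w (ext@((S≤ , w≥0) , x≉𝟎 , face) , ¬trivial)
    -- The first piece is in P by minimality of the cuts, the second because S is at most their
    -- weight.
    with face [ minValue w , w ] [ (λ I → S I - minValue w I) , 𝟎 ]
           ((λ W I → proj₂ (proj₂ (minCut w I)) W) , w≥0)
           (≤0⇒P λ I → x≤y⇒x-y≤0 (S≤ _ I (proj₁ (proj₂ (minCut w I)))))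
           [ (λ I → trans (+-comm _ _) (x-y+y≈x (S I) (minValue w I))) , (λ e → +-identityʳ (w e)) ]
  ... | _ , (t , _ , z≈tx) with t ≟ 0#
  -- Here the second piece is zero, so S is the vector of minimum cuts of w.
  ...   | yes t≈0 = realizable⇒H (w , realizes w≥0 (λ I W → S≤ W I) λ I →
    let W , ext , _ = minCut w I in
    W , ext , x∙y⁻¹≈ε⇒x≈y (S I) _ (trans (z≈tx (inj₁ I)) (trans (*-congʳ t≈0) (zeroˡ _))))
  -- Here the zero weights of the second piece force w = 0, hence S ≤ 0. Nontriviality excludes a
  -- negative coordinate, so the ray would be zero.
  ...   | no t≉0  = contradiction [ S≋𝟎 , w≋𝟎 ] x≉𝟎
    where
    w≋𝟎 : w ≋ 𝟎
    w≋𝟎 e = *-cancelˡ-≈0 t≉0 (sym (z≈tx (inj₂ e)))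

    S≤0 : ∀ I → S I ≤ᴿ 0#
    S≤0 I = ≤-trans (S≤ _ I (self-extends I)) (≤-reflexive (⟦𝟎⟧≈0 (cut (TerminalSet.set I)) w≋𝟎))

    S≋𝟎 : S ≋ 𝟎
    S≋𝟎 I = decidable-stable (S I ≟ 0#) λ S≉0 → ¬trivial (negative⇒trivial ext w≋𝟎 S≤0 I S≉0)

open import Data.Nat.Base using (_+_)

theorem2 : ∀ {c ℓ₁ ℓ₂} (ℝ : RealField c ℓ₁ ℓ₂) (n N : ℕ) →
    3 ≤ n + 1 → n + 1 ≤ N →
    let open Cuts ℝ N n in
    ((S : Vect (TerminalSet N n)) (w : Vect (Edge N)) →
    NontrivialExtremeRay [ S , w ] → H S) ×
    ((S : Vect (TerminalSet N n)) → ExtremeRay H S →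
    ∃[ w ] NontrivialExtremeRay [ S , w ])
theorem2 ℝ n N _ n+1≤N = nontrivialExtreme⇒H , extreme⇒nontrivialExtreme
  where open CutCones ℝ N n (ℕ.≤-trans (ℕ.≤-reflexive (ℕ.+-comm 1 n)) n+1≤N)
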